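{- $A_4(12,8) \leq 240$.
   Context: For $m \in \mathbb{N}$, $[m] = \{1,\ldots,m\}$. An $(n,d)_q$-code is a set $C \subseteq [q]^n$ in which any two distinct words have Hamming distance at least $d$. $A_q(n,d)$ denotes the maximum size of an $(n,d)_q$-code. -}

module Defs where

open import Data.Nat using (ℕ; zero; suc; _≤_)
open import Data.Fin using (Fin)
open import Data.Fin.Properties using (_≟_)
open import Data.Vec using (Vec; []; _∷_)
open import Data.List using (List; length)
open import Data.List.Relation.Unary.AllPairs using (AllPairs)
open import Relation.Binary.PropositionalEquality using (_≡_)
open import Relation.Nullary using (¬_; yes; no)

Word : ℕ → ℕ → Set
Word q n = Vec (Fin q) n

hamming : ∀ {q n} → Word q n → Word q n → ℕ
hamming []       []       = zero
hamming (x ∷ xs) (y ∷ ys) with x ≟ y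
... | yes _ = hamming xs ys
... | no  _ = suc (hamming xs ys)

-- An (n,d)_q-code, given as a list of words: the words are pairwise
-- distinct and any two distinct words have Hamming distance ≥ d.
-- (The code C is the set of entries; its size is the list length.)
IsCode : (q n d : ℕ) → List (Word q n) → Set
IsCode q n d C = AllPairs (λ u v → ¬ (u ≡ v) × (d ≤ hamming u v)) C
  where open import Data.Product using (_×_)

A≤ : (q n d m : ℕ) → Set
A≤ q n d m = (C : List (Word q n)) → IsCode q n d C → length C ≤ m

module Submission where

-- Delsarte's linear programming bound, sharpened by integrality. For functions g on words write
-- s_g = ∑_{x ∈ C} g x; the kernel K_G x y = ∑_{g ∈ G} g x · g y of a family G then satisfies
-- ∑_{x,y ∈ C} K_G x y = ∑_{g ∈ G} s_g² ≥ 0. The certificate is Φ = 15 K_F₂ + 7 K_F₃ + 212 K_I₃ − 330, where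
-- F_k consists of the products of nontrivial characters of ℤ₂ × ℤ₂ at k positions (so K_F_k is a Krawtchouk
-- polynomial in the distance) and I₃ of the products of symbol indicators at 3 positions (so K_I₃ x y counts
-- the 3-sets of positions where x and y agree). Φ is ≤ 0 at distance ≥ 8 and equals 96800 at distance 0,
-- so ∑_{x,y ∈ C} Φ ≤ 96800 |C|. For the indicator family the s_g are integers with ∑_g s_g = 220 |C|,
-- so s_g² ≥ 7 s_g − 12; together with the nonnegativity of the other two kernel sums this gives a lower
-- bound on ∑_{x,y ∈ C} Φ that exceeds 96800 |C| when |C| = 241.

open import Defs
open import Function using (_∘_; const)
open import Data.Empty using (⊥; ⊥-elim)
open import Data.Product using (proj₂)
open import Data.Nat as ℕ using (ℕ; zero; suc)
import Data.Nat.Properties as ℕₚ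
open import Data.Nat.Combinatorics using (nCk+nC[k+1]≡[n+1]C[k+1]) renaming (_C_ to _choose_)
open import Data.Integer as ℤ using (ℤ; +_; -[1+_]; -_; _+_; _*_; _-_; _≤_; +≤+; 0ℤ; 1ℤ; -1ℤ)
import Data.Integer.Properties as ℤₚ
open import Data.Integer.Tactic.RingSolver using (solve-∀)
open import Algebra.Properties.CommutativeSemigroup ℤₚ.+-commutativeSemigroup
  using (xy∙z≈xz∙y) renaming (interchange to +-interchange)
open import Algebra.Properties.CommutativeSemigroup ℤₚ.*-commutativeSemigroup
  using () renaming (interchange to *-interchange)
open import Data.Fin using (Fin)
open import Data.Fin.Properties using (_≟_; all?)
open import Data.Vec using ([]; _∷_; tail; lookup)
open import Data.List using (List; []; _∷_; [_]; length; map; _++_; concatMap; take; allFin)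
open import Data.List.Properties using (length-take)
open import Data.List.Relation.Unary.All as All using (All; []; _∷_)
open import Data.List.Relation.Unary.AllPairs using (AllPairs; []; _∷_)
import Data.List.Relation.Unary.AllPairs.Properties as AllPairs
open import Relation.Binary.PropositionalEquality using (_≡_; refl; sym; trans; cong; cong₂; subst; module ≡-Reasoning)
open import Relation.Nullary using (yes; no)
open import Relation.Nullary.Decidable using (toWitness)

∑ : {A : Set} → (A → ℤ) → List A → ℤ
∑ f []       = 0ℤ
∑ f (x ∷ xs) = f x + ∑ f xs

infix 5 ∑
syntax ∑ (λ x → e) xs = ∑[ x ∈ xs ] e

module _ {A : Set} where

  ∑-cong : ∀ {f g : A → ℤ} xs → (∀ x → f x ≡ g x) → ∑ f xs ≡ ∑ g xs
  ∑-cong []       f≗g = refl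
  ∑-cong (x ∷ xs) f≗g = cong₂ _+_ (f≗g x) (∑-cong xs f≗g)

  ∑-zero : ∀ (xs : List A) → ∑[ x ∈ xs ] 0ℤ ≡ 0ℤ
  ∑-zero []       = refl
  ∑-zero (x ∷ xs) = trans (ℤₚ.+-identityˡ _) (∑-zero xs)

  ∑-+ : ∀ (f g : A → ℤ) xs → ∑[ x ∈ xs ] (f x + g x) ≡ ∑ f xs + ∑ g xs
  ∑-+ f g []       = refl
  ∑-+ f g (x ∷ xs) = trans (cong (_+_ (f x + g x)) (∑-+ f g xs)) (+-interchange (f x) (g x) _ _)

  ∑-*ˡ : ∀ c (f : A → ℤ) xs → ∑[ x ∈ xs ] (c * f x) ≡ c * ∑ f xs
  ∑-*ˡ c f []       = sym (ℤₚ.*-zeroʳ c)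
  ∑-*ˡ c f (x ∷ xs) = trans (cong (_+_ (c * f x)) (∑-*ˡ c f xs)) (sym (ℤₚ.*-distribˡ-+ c (f x) _))

  ∑-*ʳ : ∀ c (f : A → ℤ) xs → ∑[ x ∈ xs ] (f x * c) ≡ ∑ f xs * c
  ∑-*ʳ c f []       = sym (ℤₚ.*-zeroˡ c)
  ∑-*ʳ c f (x ∷ xs) = trans (cong (_+_ (f x * c)) (∑-*ʳ c f xs)) (sym (ℤₚ.*-distribʳ-+ c (f x) _))

  ∑-const : ∀ c (xs : List A) → ∑[ x ∈ xs ] c ≡ + length xs * c
  ∑-const c []       = sym (ℤₚ.*-zeroˡ c)
  ∑-const c (x ∷ xs) = trans (cong (_+_ c) (∑-const c xs)) (sym (ℤₚ.suc-* (+ length xs) c))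

  ∑-++ : ∀ (f : A → ℤ) xs ys → ∑ f (xs ++ ys) ≡ ∑ f xs + ∑ f ys
  ∑-++ f []       ys = sym (ℤₚ.+-identityˡ _)
  ∑-++ f (x ∷ xs) ys = trans (cong (_+_ (f x)) (∑-++ f xs ys)) (sym (ℤₚ.+-assoc (f x) _ _))

  ∑-mono-≤ : ∀ {f g : A → ℤ} xs → (∀ x → f x ≤ g x) → ∑ f xs ≤ ∑ g xs
  ∑-mono-≤ []       f≤g = ℤₚ.≤-refl
  ∑-mono-≤ (x ∷ xs) f≤g = ℤₚ.+-mono-≤ (f≤g x) (∑-mono-≤ xs f≤g)

  ∑-nonNeg : ∀ {f : A → ℤ} xs → (∀ x → 0ℤ ≤ f x) → 0ℤ ≤ ∑ f xs
  ∑-nonNeg {f} xs 0≤f = subst (_≤ ∑ f xs) (∑-zero xs) (∑-mono-≤ xs 0≤f)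

  ∑-nonPos : ∀ {f : A → ℤ} {xs} → All (λ x → f x ≤ 0ℤ) xs → ∑ f xs ≤ 0ℤ
  ∑-nonPos []           = ℤₚ.≤-refl
  ∑-nonPos (fx≤0 ∷ f≤0) = ℤₚ.+-mono-≤ fx≤0 (∑-nonPos f≤0)

module _ {A B : Set} where

  ∑-map : ∀ (f : B → ℤ) (h : A → B) xs → ∑ f (map h xs) ≡ ∑ (f ∘ h) xs
  ∑-map f h []       = refl
  ∑-map f h (x ∷ xs) = cong (_+_ (f (h x))) (∑-map f h xs)

  ∑-concatMap : ∀ (f : B → ℤ) (h : A → List B) xs → ∑ f (concatMap h xs) ≡ ∑[ x ∈ xs ] ∑ f (h x)
  ∑-concatMap f h []       = refl
  ∑-concatMap f h (x ∷ xs) = trans (∑-++ f (h x) (concatMap h xs)) (cong (_+_ (∑ f (h x))) (∑-concatMap f h xs))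

  ∑-comm : ∀ (f : A → B → ℤ) xs ys → ∑[ x ∈ xs ] ∑[ y ∈ ys ] f x y ≡ ∑[ y ∈ ys ] ∑[ x ∈ xs ] f x y
  ∑-comm f []       ys = sym (∑-zero ys)
  ∑-comm f (x ∷ xs) ys = trans (cong (_+_ (∑ (f x) ys)) (∑-comm f xs ys)) (sym (∑-+ (f x) _ ys))

∑∑ : {A : Set} → (A → A → ℤ) → List A → ℤ
∑∑ f C = ∑[ x ∈ C ] ∑[ y ∈ C ] f x y

module _ {A : Set} where

  ∑∑-+ : ∀ (f g : A → A → ℤ) C → ∑∑ (λ x y → f x y + g x y) C ≡ ∑∑ f C + ∑∑ g C
  ∑∑-+ f g C = trans (∑-cong C (λ x → ∑-+ (f x) (g x) C)) (∑-+ _ _ C)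

  ∑∑-*ˡ : ∀ c (f : A → A → ℤ) C → ∑∑ (λ x y → c * f x y) C ≡ c * ∑∑ f C
  ∑∑-*ˡ c f C = trans (∑-cong C (λ x → ∑-*ˡ c (f x) C)) (∑-*ˡ c _ C)

  ∑∑-*-+ : ∀ c (f g : A → A → ℤ) C → ∑∑ (λ x y → c * f x y + g x y) C ≡ c * ∑∑ f C + ∑∑ g C
  ∑∑-*-+ c f g C = trans (∑∑-+ (λ x y → c * f x y) g C) (cong (_+ ∑∑ g C) (∑∑-*ˡ c f C))

  ∑∑-const : ∀ c (C : List A) → ∑∑ (λ _ _ → c) C ≡ + length C * (+ length C * c)
  ∑∑-const c C = trans (∑-cong C (λ _ → ∑-const c C)) (∑-const _ C)

  ∑∑-∷ : ∀ (f : A → A → ℤ) x C →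
         ∑∑ f (x ∷ C) ≡ f x x + (∑[ y ∈ C ] (f x y + f y x)) + ∑∑ f C
  ∑∑-∷ f x C = begin
    (f x x + ∑ (f x) C) + (∑[ y ∈ C ] (f y x + ∑ (f y) C))
      ≡⟨ cong (_+_ (f x x + ∑ (f x) C)) (∑-+ (λ y → f y x) (λ y → ∑ (f y) C) C) ⟩
    (f x x + ∑ (f x) C) + ((∑[ y ∈ C ] f y x) + ∑∑ f C)
      ≡⟨ regroup (f x x) _ _ _ ⟩
    f x x + (∑ (f x) C + (∑[ y ∈ C ] f y x)) + ∑∑ f C
      ≡⟨ cong (λ s → f x x + s + ∑∑ f C) (sym (∑-+ (f x) (λ y → f y x) C)) ⟩
    f x x + (∑[ y ∈ C ] (f x y + f y x)) + ∑∑ f C ∎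
    where
    open ≡-Reasoning
    regroup : ∀ a b c d → (a + b) + (c + d) ≡ a + (b + c) + d
    regroup = solve-∀

  ∑∑-code-≤ : ∀ {R : A → A → Set} (f : A → A → ℤ) c →
              (∀ x y → f x y ≡ f y x) → (∀ x → f x x ≤ c) → (∀ {x y} → R x y → f x y ≤ 0ℤ) →
              ∀ {C} → AllPairs R C → ∑∑ f C ≤ + length C * c
  ∑∑-code-≤ f c f-sym fxx≤c f≤0 {[]}    []         = ℤₚ.≤-reflexive (sym (ℤₚ.*-zeroˡ c))
  ∑∑-code-≤ f c f-sym fxx≤c f≤0 {x ∷ C} (Rx ∷ RC) = begin
    ∑∑ f (x ∷ C)                                  ≡⟨ ∑∑-∷ f x C ⟩
    f x x + (∑[ y ∈ C ] (f x y + f y x)) + ∑∑ f C  ≤⟨ ℤₚ.+-mono-≤ (ℤₚ.+-mono-≤ (fxx≤c x) cross≤0)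
                                                                 (∑∑-code-≤ f c f-sym fxx≤c f≤0 RC) ⟩
    c + 0ℤ + + length C * c                        ≡⟨ cong (_+ + length C * c) (ℤₚ.+-identityʳ c) ⟩
    c + + length C * c                             ≡⟨ sym (ℤₚ.suc-* (+ length C) c) ⟩
    + length (x ∷ C) * c                           ∎
    where
    open ℤₚ.≤-Reasoning
    cross≤0 : ∑[ y ∈ C ] (f x y + f y x) ≤ 0ℤ
    cross≤0 = ∑-nonPos (All.map (λ Rxy → ℤₚ.+-mono-≤ (f≤0 Rxy) (subst (_≤ 0ℤ) (f-sym _ _) (f≤0 Rxy))) Rx)

kernel : {A : Set} → List (A → ℤ) → A → A → ℤ
kernel G x y = ∑[ g ∈ G ] g x * g y

kernel-sym : ∀ {A : Set} (G : List (A → ℤ)) x y → kernel G x y ≡ kernel G y x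
kernel-sym G x y = ∑-cong G (λ g → ℤₚ.*-comm (g x) (g y))

square-nonNeg : ∀ i → 0ℤ ≤ i * i
square-nonNeg (+ n)    = subst (0ℤ ≤_) (ℤₚ.pos-* n n) (+≤+ ℕ.z≤n)
square-nonNeg -[1+ n ] = +≤+ ℕ.z≤n

∑∑-kernel : ∀ {A : Set} (G : List (A → ℤ)) C → ∑∑ (kernel G) C ≡ ∑[ g ∈ G ] ((∑[ x ∈ C ] g x) * (∑[ x ∈ C ] g x))
∑∑-kernel G C = begin
  ∑[ x ∈ C ] ∑[ y ∈ C ] ∑[ g ∈ G ] g x * g y       ≡⟨ ∑-cong C (λ x → ∑-comm (λ y g → g x * g y) C G) ⟩
  ∑[ x ∈ C ] ∑[ g ∈ G ] ∑[ y ∈ C ] g x * g y       ≡⟨ ∑-comm (λ x g → ∑[ y ∈ C ] g x * g y) C G ⟩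
  ∑[ g ∈ G ] ∑[ x ∈ C ] ∑[ y ∈ C ] g x * g y       ≡⟨ ∑-cong G (λ g → ∑-cong C (λ x → ∑-*ˡ (g x) g C)) ⟩
  ∑[ g ∈ G ] ∑[ x ∈ C ] g x * (∑[ y ∈ C ] g y)     ≡⟨ ∑-cong G (λ g → ∑-*ʳ (∑[ y ∈ C ] g y) g C) ⟩
  ∑[ g ∈ G ] ((∑[ x ∈ C ] g x) * (∑[ x ∈ C ] g x)) ∎
  where open ≡-Reasoning

∑∑-kernel-nonNeg : ∀ {A : Set} (G : List (A → ℤ)) C → 0ℤ ≤ ∑∑ (kernel G) C
∑∑-kernel-nonNeg G C = subst (0ℤ ≤_) (sym (∑∑-kernel G C)) (∑-nonNeg G (λ g → square-nonNeg (∑[ x ∈ C ] g x)))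

consecutive-product-nonNeg : ∀ t → 0ℤ ≤ t * (t + 1ℤ)
consecutive-product-nonNeg (+ n)    = subst (0ℤ ≤_) (ℤₚ.pos-* n (n ℕ.+ 1)) (+≤+ ℕ.z≤n)
consecutive-product-nonNeg -[1+ n ] = subst (0ℤ ≤_) (sym (negated (+ n))) (consecutive-product-nonNeg (+ n))
  where
  negated : ∀ u → (- (1ℤ + u)) * (- (1ℤ + u) + 1ℤ) ≡ u * (u + 1ℤ)
  negated = solve-∀

-- Sharp at n = k and n = k + 1: the difference is (n − k)(n − k − 1), and no integer lies strictly between k and k + 1.
square-≥ : ∀ k n → (+ 2 * k + 1ℤ) * n - k * (k + 1ℤ) ≤ n * n
square-≥ k n = begin
  (+ 2 * k + 1ℤ) * n - k * (k + 1ℤ)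
    ≡⟨ ℤₚ.+-identityʳ _ ⟨
  (+ 2 * k + 1ℤ) * n - k * (k + 1ℤ) + 0ℤ
    ≤⟨ ℤₚ.+-monoʳ-≤ ((+ 2 * k + 1ℤ) * n - k * (k + 1ℤ)) (consecutive-product-nonNeg (n - k - 1ℤ)) ⟩
  (+ 2 * k + 1ℤ) * n - k * (k + 1ℤ) + (n - k - 1ℤ) * (n - k - 1ℤ + 1ℤ)
    ≡⟨ expand k n ⟩
  n * n
    ∎
  where
  open ℤₚ.≤-Reasoning
  expand : ∀ k n → (+ 2 * k + 1ℤ) * n - k * (k + 1ℤ) + (n - k - 1ℤ) * (n - k - 1ℤ + 1ℤ) ≡ n * n
  expand = solve-∀

∑∑-kernel-≥ : ∀ {A : Set} k (G : List (A → ℤ)) m → (∀ x → ∑[ g ∈ G ] g x ≡ m) → ∀ C →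
  (+ 2 * k + 1ℤ) * (+ length C * m) + + length G * - (k * (k + 1ℤ)) ≤ ∑∑ (kernel G) C
∑∑-kernel-≥ k G m ∑G≡m C = begin
  (+ 2 * k + 1ℤ) * (+ length C * m) + + length G * - (k * (k + 1ℤ))
    ≡⟨ cong₂ _+_ (cong (_*_ (+ 2 * k + 1ℤ)) total) (∑-const (- (k * (k + 1ℤ))) G) ⟨
  (+ 2 * k + 1ℤ) * (∑[ g ∈ G ] ∑[ x ∈ C ] g x) + (∑[ g ∈ G ] - (k * (k + 1ℤ)))
    ≡⟨ cong (_+ (∑[ g ∈ G ] - (k * (k + 1ℤ)))) (∑-*ˡ (+ 2 * k + 1ℤ) (λ g → ∑[ x ∈ C ] g x) G) ⟨
  (∑[ g ∈ G ] (+ 2 * k + 1ℤ) * (∑[ x ∈ C ] g x)) + (∑[ g ∈ G ] - (k * (k + 1ℤ)))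
    ≡⟨ ∑-+ (λ g → (+ 2 * k + 1ℤ) * (∑[ x ∈ C ] g x)) (λ _ → - (k * (k + 1ℤ))) G ⟨
  ∑[ g ∈ G ] ((+ 2 * k + 1ℤ) * (∑[ x ∈ C ] g x) - k * (k + 1ℤ))
    ≤⟨ ∑-mono-≤ G (λ g → square-≥ k (∑[ x ∈ C ] g x)) ⟩
  ∑[ g ∈ G ] ((∑[ x ∈ C ] g x) * (∑[ x ∈ C ] g x))
    ≡⟨ ∑∑-kernel G C ⟨
  ∑∑ (kernel G) C
    ∎
  where
  open ℤₚ.≤-Reasoning
  total : ∑[ g ∈ G ] ∑[ x ∈ C ] g x ≡ + length C * m
  total = trans (∑-comm (λ g x → g x) G C) (trans (∑-cong C ∑G≡m) (∑-const m C))

module _ {q : ℕ} where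

  _⊗_ : ∀ {n} → (Fin q → ℤ) → (Word q n → ℤ) → Word q (suc n) → ℤ
  (c ⊗ g) (a ∷ x) = c a * g x

  -- The products c₁(x_{i₁}) ⋯ c_k(x_{i_k}) over all positions i₁ < ⋯ < i_k and all choices of cⱼ from cs.
  monomials : List (Fin q → ℤ) → ℕ → (n : ℕ) → List (Word q n → ℤ)
  monomials cs zero    n       = [ const 1ℤ ]
  monomials cs (suc k) zero    = []
  monomials cs (suc k) (suc n) =
    map (_∘ tail) (monomials cs (suc k) n) ++ concatMap (λ c → map (c ⊗_) (monomials cs k n)) cs

  ∑-monomials : ∀ cs k n (F : (Word q (suc n) → ℤ) → ℤ) →
    ∑ F (monomials cs (suc k) (suc n)) ≡
    (∑[ g ∈ monomials cs (suc k) n ] F (g ∘ tail)) + (∑[ c ∈ cs ] ∑[ g ∈ monomials cs k n ] F (c ⊗ g))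
  ∑-monomials cs k n F =
    trans (∑-++ F (map (_∘ tail) (monomials cs (suc k) n)) _)
          (cong₂ _+_ (∑-map F (_∘ tail) (monomials cs (suc k) n))
                     (trans (∑-concatMap F (λ c → map (c ⊗_) (monomials cs k n)) cs)
                            (∑-cong cs (λ c → ∑-map F (c ⊗_) (monomials cs k n)))))

  kernel-monomials-suc : ∀ cs k n a b (x y : Word q n) →
    kernel (monomials cs (suc k) (suc n)) (a ∷ x) (b ∷ y) ≡
    kernel (monomials cs (suc k) n) x y + kernel cs a b * kernel (monomials cs k n) x y
  kernel-monomials-suc cs k n a b x y = begin
    kernel (monomials cs (suc k) (suc n)) (a ∷ x) (b ∷ y)
      ≡⟨ ∑-monomials cs k n (λ g → g (a ∷ x) * g (b ∷ y)) ⟩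
    kernel (monomials cs (suc k) n) x y + (∑[ c ∈ cs ] ∑[ g ∈ G ] (c a * g x) * (c b * g y))
      ≡⟨ cong (_+_ (kernel (monomials cs (suc k) n) x y)) (trans (∑-cong cs factor) (∑-*ʳ _ (λ c → c a * c b) cs)) ⟩
    kernel (monomials cs (suc k) n) x y + kernel cs a b * kernel G x y ∎
    where
    open ≡-Reasoning
    G = monomials cs k n
    factor : ∀ c → ∑[ g ∈ G ] (c a * g x) * (c b * g y) ≡ c a * c b * kernel G x y
    factor c = trans (∑-cong G (λ g → *-interchange (c a) (g x) (c b) (g y))) (∑-*ˡ (c a * c b) _ G)

  ∑-monomials-at : ∀ cs → (∀ a → ∑[ c ∈ cs ] c a ≡ 1ℤ) →
                   ∀ k n (x : Word q n) → ∑[ g ∈ monomials cs k n ] g x ≡ + (n choose k)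
  ∑-monomials-at cs ∑c≡1 zero    n       x       = refl
  ∑-monomials-at cs ∑c≡1 (suc k) zero    []      = refl
  ∑-monomials-at cs ∑c≡1 (suc k) (suc n) (a ∷ x) = begin
    ∑[ g ∈ monomials cs (suc k) (suc n) ] g (a ∷ x)
      ≡⟨ ∑-monomials cs k n (λ g → g (a ∷ x)) ⟩
    (∑[ g ∈ monomials cs (suc k) n ] g x) + (∑[ c ∈ cs ] ∑[ g ∈ G ] c a * g x)
      ≡⟨ cong (_+_ (∑[ g ∈ monomials cs (suc k) n ] g x)) (trans (∑-cong cs (λ c → ∑-*ˡ (c a) (λ g → g x) G))
                                                              (∑-*ʳ _ (λ c → c a) cs)) ⟩
    (∑[ g ∈ monomials cs (suc k) n ] g x) + (∑[ c ∈ cs ] c a) * (∑[ g ∈ G ] g x)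
      ≡⟨ cong₂ (λ s t → s + t * (∑[ g ∈ G ] g x)) (∑-monomials-at cs ∑c≡1 (suc k) n x) (∑c≡1 a) ⟩
    + (n choose suc k) + 1ℤ * (∑[ g ∈ G ] g x)
      ≡⟨ cong (_+_ (+ (n choose suc k))) (trans (ℤₚ.*-identityˡ _) (∑-monomials-at cs ∑c≡1 k n x)) ⟩
    + (n choose suc k) + + (n choose k)
      ≡⟨ cong +_ (trans (ℕₚ.+-comm (n choose suc k) (n choose k)) (nCk+nC[k+1]≡[n+1]C[k+1] n k)) ⟩
    + (suc n choose suc k) ∎
    where
    open ≡-Reasoning
    G = monomials cs k n

  agreements : ∀ {n} → Word q n → Word q n → ℕ
  agreements []       []       = zero
  agreements (a ∷ x) (b ∷ y) with a ≟ b
  ... | yes _ = suc (agreements x y)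
  ... | no  _ = agreements x y

  hamming-refl : ∀ {n} (x : Word q n) → hamming x x ≡ 0
  hamming-refl []      = refl
  hamming-refl (a ∷ x) with a ≟ a
  ... | yes _  = hamming-refl x
  ... | no a≢a = ⊥-elim (a≢a refl)

  agreements-refl : ∀ {n} (x : Word q n) → agreements x x ≡ n
  agreements-refl []      = refl
  agreements-refl (a ∷ x) with a ≟ a
  ... | yes _  = cong suc (agreements-refl x)
  ... | no a≢a = ⊥-elim (a≢a refl)

  hamming+agreements≡n : ∀ {n} (x y : Word q n) → hamming x y ℕ.+ agreements x y ≡ n
  hamming+agreements≡n []      []      = refl
  hamming+agreements≡n (a ∷ x) (b ∷ y) with a ≟ b
  ... | yes _ = trans (ℕₚ.+-suc (hamming x y) (agreements x y)) (cong suc (hamming+agreements≡n x y))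
  ... | no  _ = cong suc (hamming+agreements≡n x y)

  diagonal : ℤ → ℤ → Fin q → Fin q → ℤ
  diagonal α β a b with a ≟ b
  ... | yes _ = α
  ... | no  _ = β

-- The coefficient of zᵏ in (1 + α z)ᵃ (1 + β z)ᵇ.
krawtchouk : ℤ → ℤ → ℕ → ℕ → ℕ → ℤ
krawtchouk α β zero    a       b       = 1ℤ
krawtchouk α β (suc k) zero    zero    = 0ℤ
krawtchouk α β (suc k) zero    (suc b) = krawtchouk α β (suc k) zero b + β * krawtchouk α β k zero b
krawtchouk α β (suc k) (suc a) b       = krawtchouk α β (suc k) a b + α * krawtchouk α β k a b

krawtchouk-sucʳ : ∀ α β k a b →
  krawtchouk α β (suc k) a (suc b) ≡ krawtchouk α β (suc k) a b + β * krawtchouk α β k a b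
krawtchouk-sucʳ α β k       zero    b = refl
krawtchouk-sucʳ α β zero    (suc a) b rewrite krawtchouk-sucʳ α β zero a b =
  xy∙z≈xz∙y (krawtchouk α β 1 a b) (β * 1ℤ) (α * 1ℤ)
krawtchouk-sucʳ α β (suc k) (suc a) b rewrite krawtchouk-sucʳ α β (suc k) a b | krawtchouk-sucʳ α β k a b =
  exchange α β (krawtchouk α β (suc (suc k)) a b) (krawtchouk α β (suc k) a b) (krawtchouk α β k a b)
  where
  exchange : ∀ α β P Q R → (P + β * Q) + α * (Q + β * R) ≡ (P + α * Q) + β * (Q + α * R)
  exchange = solve-∀

kernel-monomials : ∀ {q} (cs : List (Fin q → ℤ)) α β → (∀ a b → kernel cs a b ≡ diagonal α β a b) →
  ∀ k {n} (x y : Word q n) → kernel (monomials cs k n) x y ≡ krawtchouk α β k (agreements x y) (hamming x y)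
kernel-monomials cs α β cs≡δ zero    x       y       = refl
kernel-monomials cs α β cs≡δ (suc k) []      []      = refl
kernel-monomials cs α β cs≡δ (suc k) (a ∷ x) (b ∷ y)
  rewrite kernel-monomials-suc cs k _ a b x y | cs≡δ a b
        | kernel-monomials cs α β cs≡δ (suc k) x y | kernel-monomials cs α β cs≡δ k x y
  with a ≟ b
... | yes _ = refl
... | no  _ = sym (krawtchouk-sucʳ α β k (agreements x y) (hamming x y))

-- The three nontrivial characters of ℤ₂ × ℤ₂, whose kernel is 4·[a ≡ b] − 1.
characters : List (Fin 4 → ℤ)
characters = lookup (1ℤ ∷ -1ℤ ∷ 1ℤ ∷ -1ℤ ∷ [])
           ∷ lookup (1ℤ ∷ 1ℤ ∷ -1ℤ ∷ -1ℤ ∷ [])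
           ∷ lookup (1ℤ ∷ -1ℤ ∷ -1ℤ ∷ 1ℤ ∷ [])
           ∷ []

indicators : List (Fin 4 → ℤ)
indicators = map (diagonal 1ℤ 0ℤ) (allFin 4)

kernel-characters : ∀ a b → kernel characters a b ≡ diagonal (+ 3) -1ℤ a b
kernel-characters = toWitness {a? = all? λ a → all? λ b → kernel characters a b ℤₚ.≟ diagonal (+ 3) -1ℤ a b} _

kernel-indicators : ∀ a b → kernel indicators a b ≡ diagonal 1ℤ 0ℤ a b
kernel-indicators = toWitness {a? = all? λ a → all? λ b → kernel indicators a b ℤₚ.≟ diagonal 1ℤ 0ℤ a b} _

∑-indicators : ∀ a → ∑[ c ∈ indicators ] c a ≡ 1ℤ
∑-indicators = toWitness {a? = all? λ a → ∑[ c ∈ indicators ] c a ℤₚ.≟ 1ℤ} _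

-- Opaque so that the typechecker never unfolds these lists (I₃ has 14080 entries) when comparing terms.
opaque
  F₂ F₃ I₃ : List (Word 4 12 → ℤ)
  F₂ = monomials characters 2 12
  F₃ = monomials characters 3 12
  I₃ = monomials indicators 3 12

opaque
  unfolding F₂ F₃ I₃

  kernel-F₂ : ∀ x y → kernel F₂ x y ≡ krawtchouk (+ 3) -1ℤ 2 (agreements x y) (hamming x y)
  kernel-F₂ = kernel-monomials characters (+ 3) -1ℤ kernel-characters 2

  kernel-F₃ : ∀ x y → kernel F₃ x y ≡ krawtchouk (+ 3) -1ℤ 3 (agreements x y) (hamming x y)
  kernel-F₃ = kernel-monomials characters (+ 3) -1ℤ kernel-characters 3

  kernel-I₃ : ∀ x y → kernel I₃ x y ≡ krawtchouk 1ℤ 0ℤ 3 (agreements x y) (hamming x y)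
  kernel-I₃ = kernel-monomials indicators 1ℤ 0ℤ kernel-indicators 3

  ∑-I₃ : ∀ x → ∑[ g ∈ I₃ ] g x ≡ + 220
  ∑-I₃ = ∑-monomials-at indicators ∑-indicators 3 12

  length-I₃ : length I₃ ≡ 14080
  length-I₃ = refl

cong₃ : ∀ {A B C D : Set} (f : A → B → C → D) {a a′ b b′ c c′} →
        a ≡ a′ → b ≡ b′ → c ≡ c′ → f a b c ≡ f a′ b′ c′
cong₃ f refl refl refl = refl

certificate : ℤ → ℤ → ℤ → ℤ
certificate s t u = + 15 * s + (+ 7 * t + (+ 212 * u + - + 330))

Φ : Word 4 12 → Word 4 12 → ℤ
Φ x y = certificate (kernel F₂ x y) (kernel F₃ x y) (kernel I₃ x y)

φ : ℕ → ℕ → ℤ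
φ a b = certificate (krawtchouk (+ 3) -1ℤ 2 a b) (krawtchouk (+ 3) -1ℤ 3 a b) (krawtchouk 1ℤ 0ℤ 3 a b)

Φ≡φ : ∀ x y → Φ x y ≡ φ (agreements x y) (hamming x y)
Φ≡φ x y = cong₃ certificate (kernel-F₂ x y) (kernel-F₃ x y) (kernel-I₃ x y)

Φ-sym : ∀ x y → Φ x y ≡ Φ y x
Φ-sym x y = cong₃ certificate (kernel-sym F₂ x y) (kernel-sym F₃ x y) (kernel-sym I₃ x y)

Φ-diagonal : ∀ x → Φ x x ≡ + 96800
Φ-diagonal x = trans (Φ≡φ x x) (cong₂ φ (agreements-refl x) (hamming-refl x))

φ-far : ∀ t a → 8 ℕ.+ t ℕ.+ a ≡ 12 → φ a (8 ℕ.+ t) ≤ 0ℤ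
φ-far 0 .4 refl = +≤+ ℕ.z≤n
φ-far 1 .3 refl = ℤ.-≤+
φ-far 2 .2 refl = +≤+ ℕ.z≤n
φ-far 3 .1 refl = +≤+ ℕ.z≤n
φ-far 4 .0 refl = ℤ.-≤+

Φ-far : ∀ {x y} → 8 ℕ.≤ hamming x y → Φ x y ≤ 0ℤ
Φ-far {x} {y} 8≤d = subst (_≤ 0ℤ) (sym (Φ≡φ x y)) (subst (λ d → φ (agreements x y) d ≤ 0ℤ) d≡8+t
  (φ-far t (agreements x y) (trans (cong (ℕ._+ agreements x y) d≡8+t) (hamming+agreements≡n x y))))
  where
  t = hamming x y ℕ.∸ 8
  d≡8+t = ℕₚ.m+[n∸m]≡n 8≤d

∑∑Φ-≤ : ∀ {C} → IsCode 4 12 8 C → ∑∑ Φ C ≤ + length C * + 96800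
∑∑Φ-≤ = ∑∑-code-≤ Φ (+ 96800) Φ-sym (ℤₚ.≤-reflexive ∘ Φ-diagonal) (Φ-far ∘ proj₂)

∑∑Φ-linear : ∀ C → ∑∑ Φ C ≡
  + 15 * ∑∑ (kernel F₂) C + (+ 7 * ∑∑ (kernel F₃) C + (+ 212 * ∑∑ (kernel I₃) C + + length C * (+ length C * - + 330)))
∑∑Φ-linear C =
  trans (∑∑-*-+ (+ 15) (kernel F₂) _ C) (cong (_+_ (+ 15 * ∑∑ (kernel F₂) C))
  (trans (∑∑-*-+ (+ 7) (kernel F₃) _ C) (cong (_+_ (+ 7 * ∑∑ (kernel F₃) C))
  (trans (∑∑-*-+ (+ 212) (kernel I₃) _ C) (cong (_+_ (+ 212 * ∑∑ (kernel I₃) C)) (∑∑-const (- + 330) C))))))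

lowerBound : ℕ → ℤ
lowerBound N = + 212 * (+ 7 * (+ N * + 220) + + 14080 * - + 12) + + N * (+ N * - + 330)

∑∑Φ-≥ : ∀ C → lowerBound (length C) ≤ ∑∑ Φ C
∑∑Φ-≥ C = begin
  lowerBound (length C)
    ≤⟨ ℤₚ.+-monoˡ-≤ Q (ℤₚ.*-monoˡ-≤-nonNeg (+ 212) ∑∑I₃-≥) ⟩
  + 212 * ∑∑ (kernel I₃) C + Q
    ≤⟨ ℤₚ.i≤j+i _ _ {{ℤ.nonNegative (weighted-nonNeg 7 F₃)}} ⟩
  + 7 * ∑∑ (kernel F₃) C + (+ 212 * ∑∑ (kernel I₃) C + Q)
    ≤⟨ ℤₚ.i≤j+i _ _ {{ℤ.nonNegative (weighted-nonNeg 15 F₂)}} ⟩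
  + 15 * ∑∑ (kernel F₂) C + (+ 7 * ∑∑ (kernel F₃) C + (+ 212 * ∑∑ (kernel I₃) C + Q))
    ≡⟨ ∑∑Φ-linear C ⟨
  ∑∑ Φ C
    ∎
  where
  open ℤₚ.≤-Reasoning
  Q = + length C * (+ length C * - + 330)
  ∑∑I₃-≥ : + 7 * (+ length C * + 220) + + 14080 * - + 12 ≤ ∑∑ (kernel I₃) C
  ∑∑I₃-≥ = subst (λ l → + 7 * (+ length C * + 220) + + l * - + 12 ≤ ∑∑ (kernel I₃) C) {length I₃} {14080} length-I₃
                 (∑∑-kernel-≥ (+ 3) I₃ (+ 220) ∑-I₃ C)
  weighted-nonNeg : ∀ w G → 0ℤ ≤ + w * ∑∑ (kernel G) C
  weighted-nonNeg w G = subst (_≤ + w * ∑∑ (kernel G) C) (ℤₚ.*-zeroʳ (+ w)) (ℤₚ.*-monoˡ-≤-nonNeg (+ w) (∑∑-kernel-nonNeg G C))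

-- The two bounds on ∑∑ Φ C contradict each other exactly when 236 ≤ |C| ≤ 460.
no-code-of-size-241 : ∀ {C} → IsCode 4 12 8 C → length C ≡ 241 → ⊥
no-code-of-size-241 {C} code |C|≡241 =
  ℤₚ.<⇒≱ upper<lower (subst (λ N → lowerBound N ≤ + N * + 96800) |C|≡241 (ℤₚ.≤-trans (∑∑Φ-≥ C) (∑∑Φ-≤ code)))
  where
  upper<lower : + 241 * + 96800 ℤ.< lowerBound 241
  upper<lower = toWitness {a? = + 241 * + 96800 ℤₚ.<? lowerBound 241} _

corollary11 : A≤ 4 12 8 240
corollary11 C code with length C ℕ.≤? 240
... | yes |C|≤240 = |C|≤240
... | no  |C|≰240 = ⊥-elim (no-code-of-size-241 (AllPairs.take⁺ 241 code) |take|≡241)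
  where
  |take|≡241 : length (take 241 C) ≡ 241
  |take|≡241 = trans (length-take 241 C) (ℕₚ.m≤n⇒m⊓n≡m (ℕₚ.≰⇒> |C|≰240))
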